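{- Let $P$ be a poset with no infinite antichain and $\alpha$ a countable ordinal. Then $AM_2(P)$ is $\alpha$-bqo if and only if $\bigcup AM_2(P)$ is $\alpha$-bqo.
   Context: $AM_2(P)$ is the set of maximal antichains of $P$ having exactly two elements, ordered by domination: $X\leq Y$ iff for every $x\in X$ there is $y\in Y$ with $x\leq y$. $\bigcup AM_2(P)$ is the union of all these antichains, with the order induced from $P$. Barriers and $\alpha$-bqo: finite subsets of $\mathbb{N}$ are identified with their increasing enumerations. For finite $s,t\subseteq\mathbb{N}$ write $s\triangleleft t$ if there is a finite $r\subseteq\mathbb{N}$ such that $s$ is a proper initial segment of $r$ and $t$ is $r$ with its least element removed. A barrier is an infinite set $B$ of finite subsets of $\mathbb{N}$, no member of which is a proper subset of another, such that every infinite $X\subseteq\bigcup B$ has a nonempty initial segment belonging to $B$. A barrier is well-ordered by the lexicographic order; its order type is the type of this well-order. A map $f$ from a barrier $B$ into a quasi-ordered set $Q$ is good if there exist $s,t\in B$ with $s\triangleleft t$ and $f(s)\leq f(t)$, and bad otherwise. $Q$ is $\alpha$-bqo if every map from a barrier of order type at most $\alpha$ into $Q$ is good. -}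

module Defs where

open import Level using (Level; 0ℓ; _⊔_) renaming (suc to lsuc)
open import Data.Nat.Base as ℕ using (ℕ; _<_)
open import Data.List.Base using (List; []; tail)
open import Data.List.Membership.Propositional using () renaming (_∈_ to _∈ₗ_)
import Data.List.Membership.Setoid as SetoidMembership
open import Data.List.Relation.Binary.Lex.Strict using (Lex-<)
open import Data.List.Relation.Binary.Prefix.Heterogeneous using (Prefix)
open import Data.List.Relation.Binary.Subset.Propositional using () renaming (_⊆_ to _⊆ₗ_)
open import Data.List.Relation.Unary.Linked using (Linked)
open import Data.Maybe.Base using (just)
open import Data.Product.Base using (Σ; ∃-syntax; _×_; _,_; proj₁; proj₂)
open import Data.Refinement using (Refinement; value)
open import Data.Sum.Base using (_⊎_)
open import Function.Base using (id; _∘_)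
open import Function.Bundles using (_↣_)
open import Induction.WellFounded using (WellFounded)
open import Relation.Binary.Bundles using (Setoid; Poset; Preorder)
open import Relation.Binary.Core using (Rel)
open import Relation.Binary.Definitions using (_Respects_)
open import Relation.Binary.Structures using (IsStrictTotalOrder)
import Relation.Binary.Construct.On as On
open import Relation.Binary.PropositionalEquality using (_≡_; _≢_; setoid)
open import Relation.Nullary.Negation using (¬_)
open import Relation.Unary using (Pred; _∈_; _⊆_; _≐_)

private
  variable
    a b c ℓ ℓ₁ ℓ₂ : Level

module _ (S : Setoid a b) where
  open Setoid S using (Carrier)
  open SetoidMembership S using () renaming (_∈_ to _∈ₛ_)

  Finite : Pred Carrier ℓ → Set (a ⊔ b ⊔ ℓ)
  Finite A = ∃[ xs ] (∀ x → x ∈ A → x ∈ₛ xs)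

  Infinite : Pred Carrier ℓ → Set (a ⊔ b ⊔ ℓ)
  Infinite A = ¬ Finite A

-- A finite subset of ℕ is a strictly increasing list; two increasing lists
-- with the same members are equal, and initial segments are prefixes.

Increasing : Pred (List ℕ) 0ℓ
Increasing = Linked _<_

ProperInitialSegment : Rel (List ℕ) 0ℓ
ProperInitialSegment s r = Prefix _≡_ s r × s ≢ r

-- As r is increasing, its tail is r with its least element removed.

infix 4 _◁_
_◁_ : Rel (List ℕ) 0ℓ
s ◁ t = ∃[ r ] Increasing r × ProperInitialSegment s r × tail r ≡ just t

⋃ₗ : Pred (List ℕ) 0ℓ → Pred ℕ 0ℓ
⋃ₗ B n = ∃[ s ] s ∈ B × n ∈ₗ s

InitialSegmentOf : Pred ℕ 0ℓ → Pred (List ℕ) 0ℓ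
InitialSegmentOf X s =
  (∀ m → m ∈ₗ s → m ∈ X) × (∀ m n → m ∈ₗ s → n ∈ X → n ℕ.≤ m → n ∈ₗ s)

record IsBarrier (B : Pred (List ℕ) 0ℓ) : Set (lsuc 0ℓ) where
  field
    increasing : B ⊆ Increasing
    infinite   : Infinite (setoid (List ℕ)) B
    antichain  : ∀ s t → s ∈ B → t ∈ B → s ⊆ₗ t → s ≡ t
    covering   : (X : Pred ℕ 0ℓ) → Infinite (setoid ℕ) X → X ⊆ ⋃ₗ B →
                 ∃[ s ] s ∈ B × s ≢ [] × s ∈ InitialSegmentOf X

-- Membership proofs are irrelevant in Refinement, so a function on Elements B
-- depends only on the underlying finite sets.

Elements : Pred (List ℕ) 0ℓ → Set
Elements B = Refinement (List ℕ) B

infix 4 _<ₗₑₓ_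
_<ₗₑₓ_ : Rel (List ℕ) 0ℓ
_<ₗₑₓ_ = Lex-< _≡_ _<_

-- A countable ordinal (possibly finite), given as a well-ordered set that
-- injects into ℕ; it stands for the order type of that set.

record CountableOrdinal : Set (lsuc 0ℓ) where
  infix 4 _≺_
  field
    Carrier            : Set
    _≺_                : Rel Carrier 0ℓ
    isStrictTotalOrder : IsStrictTotalOrder _≡_ _≺_
    wellFounded        : WellFounded _≺_
    countable          : Carrier ↣ ℕ

-- The lexicographic order on B has type at most α when it is isomorphic to an
-- initial segment of α.  A strictly monotone map between strict total orders
-- is an isomorphism onto its image.

record OrderTypeAtMost (α : CountableOrdinal) (B : Pred (List ℕ) 0ℓ) : Set where
  open CountableOrdinal α
  field
    embed    : Elements B → Carrier
    monotone : ∀ s t → value s <ₗₑₓ value t → embed s ≺ embed t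
    initial  : ∀ s x → x ≺ embed s → ∃[ t ] embed t ≡ x

module _ (Q : Preorder c ℓ₁ ℓ₂) where
  open Preorder Q

  Good : (B : Pred (List ℕ) 0ℓ) → (Elements B → Carrier) → Set ℓ₂
  Good B f = ∃[ s ] ∃[ t ] value s ◁ value t × f s ≲ f t

  Bqo : CountableOrdinal → Set (lsuc 0ℓ ⊔ c ⊔ ℓ₂)
  Bqo α = (B : Pred (List ℕ) 0ℓ) → IsBarrier B → OrderTypeAtMost α B →
          (f : Elements B → Carrier) → Good B f

-- Subsets of P are predicates compatible with the equality _≈_ of P, valued in
-- a level at which quantification over elements of P is available.

module _ (P : Poset c ℓ₁ ℓ₂) where
  open Poset P

  Subset : Set (lsuc (c ⊔ ℓ₁ ⊔ ℓ₂))
  Subset = Pred Carrier (c ⊔ ℓ₁ ⊔ ℓ₂)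

  record IsAntichain (A : Subset) : Set (c ⊔ ℓ₁ ⊔ ℓ₂) where
    field
      respects     : A Respects _≈_
      incomparable : ∀ x y → x ∈ A → y ∈ A → ¬ x ≈ y → ¬ x ≤ y

  NoInfiniteAntichain : Set (lsuc (c ⊔ ℓ₁ ⊔ ℓ₂))
  NoInfiniteAntichain = ¬ (∃[ A ] IsAntichain A × Infinite Eq.setoid A)

  record IsMaximalAntichain (A : Subset) : Set (lsuc (c ⊔ ℓ₁ ⊔ ℓ₂)) where
    field
      isAntichain : IsAntichain A
      maximal     : ∀ A′ → IsAntichain A′ → A ⊆ A′ → A′ ⊆ A

  HasExactlyTwoElements : Subset → Set (c ⊔ ℓ₁ ⊔ ℓ₂)
  HasExactlyTwoElements A =
    ∃[ x ] ∃[ y ] x ∈ A × y ∈ A × ¬ x ≈ y × (∀ z → z ∈ A → z ≈ x ⊎ z ≈ y)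

  record TwoMaximalAntichain : Set (lsuc (c ⊔ ℓ₁ ⊔ ℓ₂)) where
    field
      set                : Subset
      isMaximalAntichain : IsMaximalAntichain set
      twoElements        : HasExactlyTwoElements set
  open TwoMaximalAntichain using (set)

  Dominated : Rel Subset (c ⊔ ℓ₁ ⊔ ℓ₂)
  Dominated X Y = ∀ x → x ∈ X → ∃[ y ] y ∈ Y × x ≤ y

  AM₂ : Preorder (lsuc (c ⊔ ℓ₁ ⊔ ℓ₂)) (c ⊔ ℓ₁ ⊔ ℓ₂) (c ⊔ ℓ₁ ⊔ ℓ₂)
  AM₂ = record
    { Carrier    = TwoMaximalAntichain
    ; _≈_        = λ X Y → set X ≐ set Y
    ; _≲_        = λ X Y → Dominated (set X) (set Y)
    ; isPreorder = record
      { isEquivalence = record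
        { refl  = id , id
        ; sym   = λ (p , q) → q , p
        ; trans = λ (p , q) (p′ , q′) → p′ ∘ p , q ∘ q′
        }
      ; reflexive = λ (p , _) x x∈X → x , p x∈X , refl
      ; trans     = λ X≤Y Y≤Z x x∈X →
          let y , y∈Y , x≤y = X≤Y x x∈X
              z , z∈Z , y≤z = Y≤Z y y∈Y
          in z , z∈Z , trans x≤y y≤z
      }
    }

  InUnion : Pred Carrier (lsuc (c ⊔ ℓ₁ ⊔ ℓ₂))
  InUnion x = Σ TwoMaximalAntichain λ A → x ∈ set A

  -- Equality and order on pairs are those of the first component, so different
  -- membership proofs give the same element of the union.

  ⋃AM₂ : Poset (lsuc (c ⊔ ℓ₁ ⊔ ℓ₂)) ℓ₁ ℓ₂
  ⋃AM₂ = On.poset {B = Σ Carrier InUnion} P proj₁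

{-# OPTIONS --safe #-}
module Submission where

-- Colour the infinite subsets X of the base of a barrier B by a relation between
-- the elements of B that begin two fixed subsequences of X.  Such colourings are
-- clopen, so by Nash-Williams' theorem they are constant on the subsets of some
-- infinite set.
--
-- If ⋃ AM₂(P) is α-bqo, colour X by the order between the elements that begin X
-- and X minus its minimum: on a suitable infinite set both coordinates of
-- A s = {x s, y s} are monotone along ◁, so A s ≤ A t.
--
-- Conversely let x s ∈ A s = {x s, y s}.  Colour X by the order relations between
-- A s and A u, where s begins (X 0, X 2, ...) and u begins (X 1, X 3, ...), and
-- pass to a homogeneous set.  For s ◁ t with A s ≤ A t, weaving new points into
-- the sequence begun by s gives u such that (s, u) and (u, t) have the same
-- colours.  Maximality makes x s and x t comparable to an element of A u, and
-- each case gives x s ≤ x t.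

open import Defs
open import Axiom.ExcludedMiddle using (ExcludedMiddle)
open import Function.Bundles using (_⇔_; mk⇔)
open import Relation.Binary.Bundles using (Poset; Preorder)

open import Level using (Level; 0ℓ; _⊔_; Lift; lift)
open import Data.Empty using (⊥; ⊥-elim)
open import Data.Irrelevant using ([_])
open import Data.List.Base using (List; []; _∷_; _++_; map; length; concat)
open import Data.List.Extrema.Nat using (max; xs≤max)
open import Data.List.Membership.Propositional using () renaming (_∈_ to _∈ₗ_)
open import Data.List.Membership.Propositional.Properties
  using (∈-++⁺ˡ; ∈-++⁺ʳ; ∈-map⁺; ∈-concat⁺′)
open import Data.List.Relation.Binary.Prefix.Heterogeneous using (Prefix; []; _∷_)
open import Data.List.Relation.Binary.Subset.Propositional using () renaming (_⊆_ to _⊆ₗ_)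
open import Data.List.Relation.Unary.All as All using (All; []; _∷_)
open import Data.List.Relation.Unary.Any using (here; there)
open import Data.List.Relation.Unary.Linked as Linked using ([]; [-]; _∷_)
open import Data.List.Relation.Unary.Linked.Properties using (Linked⇒All)
open import Data.Nat.Base
  using (ℕ; zero; suc; _+_; _≤_; _<_; z≤n; s≤s; s≤s⁻¹; z<s; s<s; s<s⁻¹)
import Data.Nat.Properties as ℕ
open import Data.Product.Base using (Σ; ∃; ∃-syntax; _×_; _,_; proj₁; proj₂)
open import Data.Refinement using (value; refine; _,_)
open import Data.Sum.Base as Sum using (_⊎_; inj₁; inj₂)
open import Function.Base using (_∘_; id)
open import Induction.WellFounded using (Acc; acc)
open import Relation.Binary.Core using (Rel)
open import Relation.Binary.Definitions using (tri<; tri≈; tri>)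
open import Relation.Binary.Structures using (IsStrictTotalOrder)
open import Relation.Binary.PropositionalEquality
  using (_≡_; _≢_; _≗_; refl; sym; trans; cong; subst; subst₂; setoid)
open import Relation.Nullary using (¬_; yes; no; recompute)
open import Relation.Unary using (Pred; _∈_; _⊆_; ∁)

private
  variable
    a ℓ : Level
    m n : ℕ
    s t : List ℕ
    f g h : ℕ → ℕ

-- Increasing sequences and their subsequences

Incr : Pred (ℕ → ℕ) 0ℓ
Incr f = ∀ i → f i < f (suc i)

incr-mono : Incr f → m < n → f m < f n
incr-mono {n = suc n} inc m<1+n with ℕ.m≤n⇒m<n∨m≡n (s≤s⁻¹ m<1+n)
... | inj₁ m<n  = ℕ.<-trans (incr-mono inc m<n) (inc n)
... | inj₂ refl = inc n

incr-cancel : Incr f → f m < f n → m < n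
incr-cancel {m = m} {n = n} inc fm<fn with ℕ.<-cmp m n
... | tri< m<n _ _  = m<n
... | tri≈ _ refl _ = ⊥-elim (ℕ.<-irrefl refl fm<fn)
... | tri> _ _ n<m  = ⊥-elim (ℕ.<-asym fm<fn (incr-mono inc n<m))

incr-≥ : Incr f → ∀ n → n ≤ f n
incr-≥ inc zero    = z≤n
incr-≥ inc (suc n) = ℕ.≤-<-trans (incr-≥ inc n) (inc n)

incr-∘ : Incr f → Incr g → Incr (f ∘ g)
incr-∘ incf incg i = incr-mono incf (incg i)

Range : (ℕ → ℕ) → Pred ℕ 0ℓ
Range h n = ∃[ j ] n ≡ h j

infix 4 _⊑_
_⊑_ : Rel (ℕ → ℕ) 0ℓ
f ⊑ h = ∀ i → Range h (f i)

⊑-refl : f ⊑ f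
⊑-refl i = i , refl

⊑-trans : f ⊑ g → g ⊑ h → f ⊑ h
⊑-trans f⊑g g⊑h i =
  let j , fi≡gj = f⊑g i
      k , gj≡hk = g⊑h j
  in k , trans fi≡gj gj≡hk

infixr 5 _◂_
_◂_ : ℕ → (ℕ → ℕ) → ℕ → ℕ
(n ◂ f) zero    = n
(n ◂ f) (suc i) = f i

◂-cong : f ≗ g → n ◂ f ≗ n ◂ g
◂-cong f≗g zero    = refl
◂-cong f≗g (suc i) = f≗g i

◂-η : f 0 ≡ n → n ◂ (f ∘ suc) ≗ f
◂-η f0≡n zero    = sym f0≡n
◂-η f0≡n (suc i) = refl

-- Clopen sets of sequences and Nash-Williams' theorem

Extensional : Pred (ℕ → ℕ) ℓ → Set ℓ
Extensional Q = ∀ {f g} → f ≗ g → Q f → Q g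

∁-extensional : {Q : Pred (ℕ → ℕ) ℓ} → Extensional Q → Extensional (∁ Q)
∁-extensional ext f≗g ¬Qf Qg = ¬Qf (ext (sym ∘ f≗g) Qg)

-- Q is clopen on I, witnessed by a well-founded tree: along every sequence in
-- I, finitely many terms decide Q.
data Clopen (I : Pred (ℕ → ℕ) 0ℓ) (Q : Pred (ℕ → ℕ) ℓ) : Set ℓ where
  all  : (∀ f → I f → Q f) → Clopen I Q
  none : (∀ f → I f → ¬ Q f) → Clopen I Q
  node : (∀ n → Clopen (I ∘ (n ◂_)) (Q ∘ (n ◂_))) → Clopen I Q

OnSubsequences : Pred (ℕ → ℕ) 0ℓ → Pred (ℕ → ℕ) ℓ → Pred (ℕ → ℕ) ℓ
OnSubsequences I Q h = ∀ f → Incr f → f ⊑ h → I f → Q f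

Homogeneous : Pred (ℕ → ℕ) 0ℓ → Pred (ℕ → ℕ) ℓ → Pred (ℕ → ℕ) ℓ
Homogeneous I Q h = OnSubsequences I Q h ⊎ OnSubsequences I (∁ Q) h

DecidedBy : Pred (ℕ → ℕ) 0ℓ → Pred (ℕ → ℕ) ℓ → (ℕ → ℕ) → Pred ℕ ℓ
DecidedBy I Q X n =
  (∀ f → (∀ i → i < n → f i ≡ X i) → I f → Q f) ⊎
  (∀ f → (∀ i → i < n → f i ≡ X i) → I f → ¬ Q f)

enumerate : {P : Pred ℕ ℓ} → (∀ N → ∃[ n ] N ≤ n × P n) →
            ∃[ g ] Incr g × (∀ i → P (g i))
enumerate {P = P} next = proj₁ ∘ e , (λ i → proj₁ (proj₂ (next _))) , proj₂ ∘ e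
  where
  e : ℕ → ∃ P
  e zero    = let n , _ , Pn = next 0 in n , Pn
  e (suc i) = let n , _ , Pn = next (suc (proj₁ (e i))) in n , Pn

-- The terms of the list, last one first, are put in front of the sequence.
prepend : List ℕ → (ℕ → ℕ) → ℕ → ℕ
prepend []      f = f
prepend (n ∷ s) f = prepend s (n ◂ f)

module _ (em : ∀ {ℓ} → ExcludedMiddle ℓ) where

  by-contradiction : {A : Set a} → ¬ ¬ A → A
  by-contradiction {A = A} ¬¬A with em {P = A}
  ... | yes x = x
  ... | no ¬x = ⊥-elim (¬¬A ¬x)

  counterexample : {A : Set a} {P : Pred A ℓ} → ¬ (∀ x → P x) → ∃[ x ] ¬ P x
  counterexample ¬∀ = by-contradiction λ ¬∃ →
    ¬∀ λ x → by-contradiction λ ¬Px → ¬∃ (x , ¬Px)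

  -- Either `P` holds beyond every bound and can be enumerated, or it never holds from some `N` on,
  -- where `Q` must hold throughout.
  pigeonhole : {P Q : Pred ℕ ℓ} → (∀ n → P n ⊎ Q n) →
               ∃[ g ] Incr g × ((∀ i → P (g i)) ⊎ (∀ i → Q (g i)))
  pigeonhole {P = P} {Q} P⊎Q with em {P = ∀ N → ∃[ n ] N ≤ n × P n}
  ... | yes often = let g , inc , Pg = enumerate often in g , inc , inj₁ Pg
  ... | no ¬often = (N +_) , (λ i → ℕ.+-monoʳ-< N (ℕ.n<1+n i)) , inj₂ eventually
    where
    N = proj₁ (counterexample ¬often)
    eventually : ∀ i → Q (N + i)
    eventually i with P⊎Q (N + i)
    ... | inj₁ p = ⊥-elim (proj₂ (counterexample ¬often) (N + i , ℕ.m≤m+n N i , p))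
    ... | inj₂ q = q

  -- Fusion: the n-th stage is homogeneous for the subtree below δ n, the first
  -- term of the previous stage; the diagonal sequence δ is then thinned out so
  -- that all its terms have the same colour.
  ramsey : {I : Pred (ℕ → ℕ) 0ℓ} {Q : Pred (ℕ → ℕ) ℓ} → Clopen I Q →
           Extensional I → Extensional Q → ∀ h → Incr h →
           ∃[ g ] Incr g × g ⊑ h × Homogeneous I Q g
  ramsey (all p)  _ _ h inc = h , inc , ⊑-refl , inj₁ λ f _ _ → p f
  ramsey (none p) _ _ h inc = h , inc , ⊑-refl , inj₂ λ f _ _ → p f
  ramsey {ℓ = ℓ} {I = I} {Q} (node d) extI extQ h₀ inc₀ =
    δ ∘ k , incr-∘ δ-incr k-incr , ⊑-trans (λ i → k i , refl) δ⊑h ,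
    Sum.map (combine Q extQ) (combine (∁ Q) (∁-extensional extQ)) colours
    where
    step : ∀ h → Incr h →
           ∃[ g ] Incr g × g ⊑ h ∘ suc × Homogeneous (I ∘ (h 0 ◂_)) (Q ∘ (h 0 ◂_)) g
    -- The recursion descends to the subtree below `h 0`; passing to `h ∘ suc` keeps all later terms
    -- above `h 0`.
    step h inc = ramsey (d (h 0)) (extI ∘ ◂-cong) (extQ ∘ ◂-cong) (h ∘ suc) (inc ∘ suc)

    stage : ℕ → ∃ Incr
    stage zero    = h₀ , inc₀
    stage (suc n) = let h , inc = stage n
                        g , inc′ , _ = step h inc
                    in g , inc′

    H : ℕ → ℕ → ℕ
    H n = proj₁ (stage n)

    H-suc : ∀ n → H (suc n) ⊑ H n ∘ suc
    H-suc n = proj₁ (proj₂ (proj₂ (step (H n) (proj₂ (stage n)))))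

    H-anti : m ≤ n → H n ⊑ H m
    H-anti {m} {n} m≤n with ℕ.m≤n⇒m<n∨m≡n m≤n
    ... | inj₂ refl = ⊑-refl
    H-anti {m} {suc n} _ | inj₁ m<n =
      ⊑-trans (⊑-trans (H-suc n) (λ i → suc i , refl)) (H-anti (s≤s⁻¹ m<n))

    δ : ℕ → ℕ
    δ n = H n 0

    δ-incr : Incr δ
    δ-incr n with H-suc n 0
    ... | j , eq = subst (δ n <_) (sym eq) (incr-mono (proj₂ (stage n)) z<s)

    δ⊑h : δ ⊑ h₀
    δ⊑h n = H-anti {0} {n} z≤n 0

    thinning = pigeonhole λ n → proj₂ (proj₂ (proj₂ (step (H n) (proj₂ (stage n)))))
    k = proj₁ thinning
    k-incr = proj₁ (proj₂ thinning)
    colours = proj₂ (proj₂ thinning)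

    combine : (R : Pred (ℕ → ℕ) ℓ) → Extensional R →
              (∀ i → OnSubsequences (I ∘ (δ (k i) ◂_)) (R ∘ (δ (k i) ◂_)) (H (suc (k i)))) →
              OnSubsequences I R (δ ∘ k)
    combine R extR on f inc f⊑ If with f⊑ 0
    ... | i , f0≡ = extR (◂-η f0≡) (on i (f ∘ suc) (inc ∘ suc) tail⊑
                      (extI (sym ∘ ◂-η f0≡) If))
      where
      -- The later terms of `f` are diagonal terms `δ (k l)` with `k l` above `k i`, and stage `k l`
      -- is a subsequence of stage `suc (k i)`.
      tail⊑ : f ∘ suc ⊑ H (suc (k i))
      tail⊑ j with f⊑ (suc j)
      ... | l , eq = subst (Range _) (sym eq)
        (H-anti {suc (k i)} {k l} (incr-cancel {m = k i} {n = k l} δ-incr δki<δkl) 0)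
        where
        δki<δkl : δ (k i) < δ (k l)
        δki<δkl = subst (_< δ (k l)) f0≡ (subst (f 0 <_) eq (incr-mono inc z<s))

  -- A node without a tree has a child without one. Following such children forever yields a
  -- sequence `X`; but `X` is decided after finitely many terms, which makes the node reached there
  -- a leaf.
  clopen : {I : Pred (ℕ → ℕ) 0ℓ} {Q : Pred (ℕ → ℕ) ℓ} →
           (∀ X → ∃ (DecidedBy I Q X)) → Clopen I Q
  clopen {ℓ = ℓ} {I = I} {Q} decided = by-contradiction λ ¬clopen →
    let open Branch ¬clopen
        n , d = decided X
    in proj₂ (branch n) (leaf n d)
    where
    Subtree : List ℕ → Set ℓ
    Subtree s = Clopen (I ∘ prepend s) (Q ∘ prepend s)

    module Branch (¬clopen : ¬ Clopen I Q) where
      child : ∀ s → ¬ Subtree s → ∃[ n ] ¬ Subtree (n ∷ s)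
      child s ¬sub = counterexample (¬sub ∘ node)

      branch : ℕ → ∃[ s ] ¬ Subtree s
      branch zero    = [] , ¬clopen
      branch (suc n) = let s , ¬sub = branch n
                           m , ¬sub′ = child s ¬sub
                       in m ∷ s , ¬sub′

      X : ℕ → ℕ
      X n = proj₁ (child (proj₁ (branch n)) (proj₂ (branch n)))

      -- The list at stage `n` has length `n`, so `f` starts at position `n`.
      prepend-rest : ∀ n f i → prepend (proj₁ (branch n)) f (n + i) ≡ f i
      prepend-rest zero    f i = refl
      prepend-rest (suc n) f i =
        trans (cong (prepend (proj₁ (branch n)) (X n ◂ f)) (sym (ℕ.+-suc n i)))
              (prepend-rest n (X n ◂ f) (suc i))

      prepend-agrees : ∀ n f i → i < n → prepend (proj₁ (branch n)) f i ≡ X i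
      prepend-agrees (suc n) f i i<1+n with ℕ.m≤n⇒m<n∨m≡n (s≤s⁻¹ i<1+n)
      ... | inj₁ i<n  = prepend-agrees n (X n ◂ f) i i<n
      ... | inj₂ refl =
        trans (cong (prepend (proj₁ (branch n)) (X n ◂ f)) (sym (ℕ.+-identityʳ n)))
              (prepend-rest n (X n ◂ f) 0)

      leaf : ∀ n → DecidedBy I Q X n → Subtree (proj₁ (branch n))
      leaf n (inj₁ p) = all  λ f → p _ (prepend-agrees n f)
      leaf n (inj₂ p) = none λ f → p _ (prepend-agrees n f)

-- Finite initial segments of sequences

infix 4 _⊏_
data _⊏_ : List ℕ → (ℕ → ℕ) → Set where
  []  : [] ⊏ f
  _∷_ : m ≡ f 0 → s ⊏ f ∘ suc → m ∷ s ⊏ f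

⊏-cong : s ⊏ f → (∀ i → i < length s → f i ≡ g i) → s ⊏ g
⊏-cong []         _  = []
⊏-cong (m≡ ∷ s⊏f) eq = trans m≡ (eq 0 z<s) ∷ ⊏-cong s⊏f (λ i i< → eq (suc i) (s<s i<))

⊏-prefix : s ⊏ f → t ⊏ f → length s ≤ length t → Prefix _≡_ s t
⊏-prefix []         _          _   = []
⊏-prefix (m≡ ∷ s⊏f) (n≡ ∷ t⊏f) s≤t =
  trans m≡ (sym n≡) ∷ ⊏-prefix s⊏f t⊏f (s≤s⁻¹ s≤t)

prefix-⊏ : Prefix _≡_ s t → t ⊏ f → s ⊏ f
prefix-⊏ []           _          = []
prefix-⊏ (refl ∷ s≤t) (n≡ ∷ t⊏f) = n≡ ∷ prefix-⊏ s≤t t⊏f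

prefix⇒⊆ : Prefix _≡_ s t → s ⊆ₗ t
prefix⇒⊆ (refl ∷ s≤t) (here eq)  = here eq
prefix⇒⊆ (refl ∷ s≤t) (there x∈) = there (prefix⇒⊆ s≤t x∈)

⊏-head : m ∷ s ⊏ f → m ≡ f 0
⊏-head (m≡ ∷ _) = m≡

⊏-increasing : s ⊏ f → Incr f → Increasing s
⊏-increasing {[]}        _            _   = []
⊏-increasing {_ ∷ []}    _            _   = [-]
⊏-increasing {_ ∷ _ ∷ _} (m≡ ∷ s⊏f) inc =
  subst₂ _<_ (sym m≡) (sym (⊏-head s⊏f)) (inc 0) ∷ ⊏-increasing s⊏f (inc ∘ suc)

⊏-range : s ⊏ f → f ⊑ h → ∀ m → m ∈ₗ s → Range h m
⊏-range (refl ∷ _)  f⊑h _ (here refl) = f⊑h 0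
⊏-range (_ ∷ s⊏f)   f⊑h m (there m∈)  = ⊏-range s⊏f (f⊑h ∘ suc) m m∈

head-least : Increasing (m ∷ s) → All (m <_) s
head-least [-]         = []
head-least (m<n ∷ inc) = Linked⇒All ℕ.<-trans m<n inc

-- The least member `f 0` of the range belongs to `s` by downward closure, so it is the head of `s`.
-- Removing it from both leaves the same situation for the tails.
initial-⊏ : Increasing s → Incr f → s ∈ InitialSegmentOf (Range f) → s ⊏ f
initial-⊏ {[]}        _    _    _            = []
initial-⊏ {m ∷ s} {f} incs incf (sub , down) =
  m≡f0 ∷ initial-⊏ (Linked.tail incs) (incf ∘ suc) (sub′ , down′)
  where
  m<s = head-least incs

  f0≤ : ∀ j → f 0 ≤ f j
  f0≤ zero    = ℕ.≤-refl
  f0≤ (suc j) = ℕ.<⇒≤ (incr-mono incf z<s)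

  m≡f0 : m ≡ f 0
  m≡f0 with sub m (here refl)
  ... | j , m≡fj with down m (f 0) (here refl) (0 , refl) (subst (f 0 ≤_) (sym m≡fj) (f0≤ j))
  ...   | here f0≡m   = sym f0≡m
  ...   | there f0∈s =
    ⊥-elim (ℕ.<⇒≱ (All.lookup m<s f0∈s) (subst (f 0 ≤_) (sym m≡fj) (f0≤ j)))

  sub′ : ∀ n → n ∈ₗ s → Range (f ∘ suc) n
  sub′ n n∈s with sub n (there n∈s)
  ... | zero  , n≡f0 = ⊥-elim (ℕ.<-irrefl (trans m≡f0 (sym n≡f0)) (All.lookup m<s n∈s))
  ... | suc j , n≡fj = j , n≡fj

  down′ : ∀ n k → n ∈ₗ s → Range (f ∘ suc) k → k ≤ n → k ∈ₗ s
  down′ n k n∈s (j , k≡) k≤n with down n k (there n∈s) (suc j , k≡) k≤n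
  ... | there k∈s = k∈s
  ... | here refl = ⊥-elim (ℕ.<-irrefl (trans (sym m≡f0) k≡) (incr-mono incf z<s))

-- The last entry of `s` is some `h j`; after it the sequence continues with the terms of `h` that
-- follow `h j`.
extend : Incr h → Increasing s → (∀ m → m ∈ₗ s → Range h m) →
         ∃[ f ] Incr f × f ⊑ h × s ⊏ f
extend {h} inc [] _ = h , inc , ⊑-refl , []
extend {h} inc ([-] {x}) s⊆h =
  let j , x≡hj = s⊆h x (here refl) in
  x ◂ (h ∘ (suc j +_)) ,
  (λ { zero    → subst (_< h (suc j + 0)) (sym x≡hj) (incr-mono inc (s≤s (ℕ.m≤m+n j 0)))
     ; (suc i) → incr-mono inc (ℕ.+-monoʳ-< (suc j) (ℕ.n<1+n i)) }) ,
  (λ { zero → j , x≡hj ; (suc i) → suc j + i , refl }) ,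
  refl ∷ []
extend inc (_∷_ {x} x<y incs) s⊆h with extend inc incs (λ m → s⊆h m ∘ there)
... | f , incf , f⊑h , refl ∷ s⊏f =
  x ◂ f ,
  (λ { zero → x<y ; (suc i) → incf i }) ,
  (λ { zero → s⊆h x (here refl) ; (suc i) → f⊑h i }) ,
  refl ∷ (refl ∷ s⊏f)

range-infinite : Incr f → Infinite (setoid ℕ) (Range f)
range-infinite {f} inc (xs , f∈xs) =
  ℕ.<⇒≱ (incr-≥ inc N) (All.lookup (xs≤max 0 xs) (f∈xs (f N) (N , refl)))
  where N = suc (max 0 xs)

-- The finite sets of numbers from `a` up to but excluding `a + n`. That there are finitely many
-- forces the union of a barrier to be unbounded.
increasingLists : ℕ → ℕ → List (List ℕ)
increasingLists a zero    = [] ∷ []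
increasingLists a (suc n) = increasingLists (suc a) n ++ map (a ∷_) (increasingLists (suc a) n)

increasingLists-complete : ∀ n a s → Increasing s → (∀ m → m ∈ₗ s → a ≤ m × m < a + n) →
                           s ∈ₗ increasingLists a n
increasingLists-complete zero a []      _ _ = here refl
increasingLists-complete zero a (m ∷ s) _ bounds =
  let a≤m , m<a = bounds m (here refl)
  in ⊥-elim (ℕ.<⇒≱ (subst (m <_) (ℕ.+-identityʳ a) m<a) a≤m)
increasingLists-complete (suc n) a [] inc _ =
  ∈-++⁺ˡ (increasingLists-complete n (suc a) [] inc λ _ ())
increasingLists-complete (suc n) a (m ∷ s) inc bounds
  with ℕ.m≤n⇒m<n∨m≡n (proj₁ (bounds m (here refl)))
... | inj₁ a<m  = ∈-++⁺ˡ (increasingLists-complete n (suc a) (m ∷ s) inc λ where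
    k k∈@(here refl) → a<m , upper k k∈
    k k∈@(there k∈s) → ℕ.<-trans a<m (All.lookup (head-least inc) k∈s) , upper k k∈)
  where
  upper : ∀ k → k ∈ₗ m ∷ s → k < suc a + n
  upper k k∈ = subst (k <_) (ℕ.+-suc a n) (proj₂ (bounds k k∈))
... | inj₂ refl = ∈-++⁺ʳ _ (∈-map⁺ (a ∷_)
  (increasingLists-complete n (suc a) s (Linked.tail inc) λ k k∈s →
    All.lookup (head-least inc) k∈s ,
    subst (k <_) (ℕ.+-suc a n) (proj₂ (bounds k (there k∈s)))))

-- Barriers and colourings of pairs of their elements

_↾_ : Pred (List ℕ) 0ℓ → (ℕ → ℕ) → Pred (List ℕ) 0ℓ
(B ↾ h) s = s ∈ B × (∀ m → m ∈ₗ s → Range h m)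

value-injective : {B : Pred (List ℕ) 0ℓ} {s t : Elements B} → value s ≡ value t → s ≡ t
value-injective {s = _ , [ _ ]} {_ , [ _ ]} refl = refl

module _ (em : ∀ {ℓ} → ExcludedMiddle ℓ) where

  -- Excluded middle decides membership, so the irrelevant proof can be recomputed.
  element∈ : {B : Pred (List ℕ) 0ℓ} (s : Elements B) → value s ∈ B
  element∈ (s , [ s∈B ]) = recompute em s∈B

module Barrier (em : ∀ {ℓ} → ExcludedMiddle ℓ) {B : Pred (List ℕ) 0ℓ} (bar : IsBarrier B) where
  open IsBarrier bar

  -- The infinite subsets of `⋃ₗ B`, as increasing enumerations.
  Base : Pred (ℕ → ℕ) 0ℓ
  Base f = Incr f × (∀ i → f i ∈ ⋃ₗ B)

  ⊑-base : Incr f → f ⊑ h → Base h → Base f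
  ⊑-base inc f⊑h (_ , h∈) = inc , λ i →
    let j , eq = f⊑h i in subst (⋃ₗ B) (sym eq) (h∈ j)

  base : ∃ Base
  base =
    let f , inc , f∈ = enumerate unbounded in f , inc , f∈
    where
    unbounded : ∀ N → ∃[ n ] N ≤ n × n ∈ ⋃ₗ B
    unbounded N = by-contradiction em λ ¬∃ → infinite
      ( increasingLists 0 N
      , λ s s∈B → increasingLists-complete N 0 s (increasing s∈B) λ m m∈s →
          z≤n , ℕ.≰⇒> λ N≤m → ¬∃ (m , N≤m , s , s∈B , m∈s))

  segment : Base f → ∃[ s ] s ∈ B × s ≢ [] × s ⊏ f
  segment {f} (inc , f∈) =
    let s , s∈B , s≢[] , initial = covering (Range f) (range-infinite inc)
          (λ (i , n≡fi) → subst (⋃ₗ B) (sym n≡fi) (f∈ i))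
    in s , s∈B , s≢[] , initial-⊏ (increasing s∈B) inc initial

  segmentᵉ : Base f → ∃[ s ] value {P = B} s ⊏ f
  segmentᵉ fB = let s , s∈B , _ , s⊏f = segment fB in (s , [ s∈B ]) , s⊏f

  -- The empty set lies inside the nonempty member provided by covering, against the antichain
  -- condition.
  nonempty : s ∈ B → s ≢ []
  nonempty s∈B refl =
    let t , t∈B , t≢[] , _ = segment (proj₂ base)
    in t≢[] (sym (antichain [] t s∈B t∈B λ ()))

  ⊏-unique : s ∈ B → t ∈ B → s ⊏ f → t ⊏ f → s ≡ t
  ⊏-unique {s} {t} s∈B t∈B s⊏f t⊏f with ℕ.≤-total (length s) (length t)
  ... | inj₁ s≤t = antichain s t s∈B t∈B (prefix⇒⊆ (⊏-prefix s⊏f t⊏f s≤t))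
  ... | inj₂ t≤s = sym (antichain t s t∈B s∈B (prefix⇒⊆ (⊏-prefix t⊏f s⊏f t≤s)))

  ⊏-uniqueᵉ : {s t : Elements B} → value s ⊏ f → value t ⊏ f → s ≡ t
  ⊏-uniqueᵉ {s = s} {t} s⊏f t⊏f =
    value-injective (⊏-unique (element∈ em s) (element∈ em t) s⊏f t⊏f)

  -- The witness is `f 0 ∷ t`. It is longer than the first set, since otherwise `t` would lie inside
  -- the tail of that set and the antichain condition would identify the two sets.
  shift-◁ : s ∈ B → t ∈ B → Incr f → s ⊏ f → t ⊏ f ∘ suc → s ◁ t
  shift-◁ s∈B t∈B inc [] t⊏f = ⊥-elim (nonempty s∈B refl)
  shift-◁ {s = m ∷ s} {t} {f} s∈B t∈B inc (refl ∷ s⊏f) t⊏f =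
    f 0 ∷ t , ⊏-increasing (refl ∷ t⊏f) inc , (refl ∷ ⊏-prefix s⊏f t⊏f (ℕ.<⇒≤ s<t) , s≢) , refl
    where
    s<t : length s < length t
    s<t = ℕ.≰⇒> λ t≤s → ℕ.<⇒≱ (ℕ.n<1+n (length s))
      (subst (λ l → length l ≤ length s)
        (antichain t (m ∷ s) t∈B s∈B (there ∘ prefix⇒⊆ (⊏-prefix t⊏f s⊏f t≤s))) t≤s)
    s≢ : m ∷ s ≢ f 0 ∷ t
    s≢ refl = ℕ.<-irrefl refl s<t

  -- Converse to `shift-◁`: the set witnessing `s ◁ t` has entries only from `s` and `t`, so it
  -- extends along `h`.
  ◁-shift : s ∈ B → t ∈ B → s ◁ t → Incr h →
            (∀ m → m ∈ₗ s → Range h m) → (∀ m → m ∈ₗ t → Range h m) →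
            ∃[ f ] Incr f × f ⊑ h × s ⊏ f × t ⊏ f ∘ suc
  ◁-shift s∈B t∈B ([] , _ , _ , ()) inc s⊆h t⊆h
  ◁-shift {s = []} s∈B _ _ _ _ _ = ⊥-elim (nonempty s∈B refl)
  ◁-shift {s = m ∷ s} s∈B t∈B (m ∷ t , incr , (refl ∷ s≤t , _) , refl) inc s⊆h t⊆h
    with extend inc incr (λ { k (here refl) → s⊆h k (here refl) ; k (there k∈) → t⊆h k k∈ })
  ... | f , incf , f⊑h , m≡ ∷ t⊏f =
    f , incf , f⊑h , prefix-⊏ (refl ∷ s≤t) (m≡ ∷ t⊏f) , t⊏f

  restrict-isBarrier : Base h → IsBarrier (B ↾ h)
  restrict-isBarrier {h} hB@(inc , _) = record
    { increasing = increasing ∘ proj₁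
    ; infinite   = λ (xs , complete) →
        -- `N` exceeds every number in the listed sets. The element beginning `h ∘ (N +_)` contains
        -- `h (N + 0)`, which is at least `N`, so it is not listed.
        let N = suc (max 0 (concat xs))
            h-N = λ i → N + i , refl
            incN = λ i → incr-mono inc (ℕ.+-monoʳ-< N (ℕ.n<1+n i))
            s , s∈B , s≢[] , s⊏ = segment (⊑-base incN h-N hB)
        in late {N = N} (ℕ.n<1+n _) s≢[] s⊏
             (complete s (s∈B , ⊏-range s⊏ h-N))
    ; antichain  = λ s t (s∈B , _) (t∈B , _) → antichain s t s∈B t∈B
    ; covering   = λ X infX X⊆ →
        let s , s∈B , s≢[] , initial@(s⊆X , _) =
              covering X infX λ n∈X → let s , (s∈B , _) , n∈s = X⊆ n∈X in s , s∈B , n∈s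
        in s , (s∈B , λ m m∈s → let t , (_ , t⊆h) , m∈t = X⊆ (s⊆X m m∈s) in t⊆h m m∈t) ,
           s≢[] , initial
    }
    where
    late : ∀ {N xs s} → max 0 (concat xs) < N → s ≢ [] → s ⊏ h ∘ (N +_) → s ∈ₗ xs → ⊥
    late _ s≢[] [] _ = s≢[] refl
    late {N} {xs} N> _ (refl ∷ _) s∈xs = ℕ.<⇒≱
      (ℕ.<-≤-trans N> (ℕ.≤-trans (ℕ.m≤m+n N 0) (incr-≥ inc (N + 0))))
      (All.lookup (xs≤max 0 (concat xs)) (∈-concat⁺′ (here refl) s∈xs))

  -- p and q select two subsequences of X, hence two elements of the barrier.
  module Colouring (p q : ℕ → ℕ) (incp : Incr p) (incq : Incr q) where

    On : {ℓ : Level} → Rel (Elements B) ℓ → (ℕ → ℕ) → Set ℓ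
    On R h = ∀ X → Incr X → X ⊑ h → ∀ s t → value s ⊏ X ∘ p → value t ⊏ X ∘ q → R s t

    Uniform : {ℓ : Level} → Rel (Elements B) ℓ → (ℕ → ℕ) → Set ℓ
    Uniform R h = On R h ⊎ On (λ s t → ¬ R s t) h

    Uniform-⊑ : {R : Rel (Elements B) ℓ} → g ⊑ h → Uniform R h → Uniform R g
    Uniform-⊑ g⊑h = Sum.map (λ on X inc X⊑g → on X inc (⊑-trans X⊑g g⊑h))
                            (λ on X inc X⊑g → on X inc (⊑-trans X⊑g g⊑h))

    Related : Rel (Elements B) ℓ → Pred (ℕ → ℕ) ℓ
    Related R X = ∃[ s ] ∃[ t ] value s ⊏ X ∘ p × value t ⊏ X ∘ q × R s t

    related : (R : Rel (Elements B) ℓ) → Clopen Base (Related R)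
    related R = clopen em decide
      where
      decide : ∀ X → ∃ (DecidedBy Base (Related R) X)
      decide X with em {P = Incr X}
      -- A failure of `Base` shows within finitely many terms. No sequence in `Base` agrees with `X`
      -- that far, so the decision is vacuous.
      ... | no ¬inc =
        let i , ¬< = counterexample em ¬inc
        in suc (suc i) , inj₁ λ f f≡X (inc , _) →
             ⊥-elim (¬< (subst (_< X (suc i)) (f≡X i (s≤s (ℕ.n≤1+n i)))
                          (subst (f i <_) (f≡X (suc i) ℕ.≤-refl) (inc i))))
      ... | yes inc with em {P = ∀ i → X i ∈ ⋃ₗ B}
      ...   | no ¬∈ =
        let i , ∉ = counterexample em ¬∈
        in suc i , inj₁ λ f f≡X (_ , f∈) →
             ⊥-elim (∉ (subst (⋃ₗ B) (f≡X i ℕ.≤-refl) (f∈ i)))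
      ...   | yes X∈ = N , decision
        where
        XB : Base X
        XB = inc , X∈
        σ = segmentᵉ (⊑-base (incr-∘ inc incp) (λ i → p i , refl) XB)
        τ = segmentᵉ (⊑-base (incr-∘ inc incq) (λ i → q i , refl) XB)
        -- Large enough that the terms of `X` before `N` determine both segments, `σ` along `p` and
        -- `τ` along `q`.
        N = p (length (value (proj₁ σ))) + q (length (value (proj₁ τ)))

        σ⊏ : ∀ f → (∀ i → i < N → f i ≡ X i) → value (proj₁ σ) ⊏ f ∘ p
        σ⊏ f f≡X = ⊏-cong (proj₂ σ) λ i i< →
          sym (f≡X (p i) (ℕ.<-≤-trans (incr-mono incp i<) (ℕ.m≤m+n _ _)))

        τ⊏ : ∀ f → (∀ i → i < N → f i ≡ X i) → value (proj₁ τ) ⊏ f ∘ q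
        τ⊏ f f≡X = ⊏-cong (proj₂ τ) λ i i< →
          sym (f≡X (q i) (ℕ.<-≤-trans (incr-mono incq i<) (ℕ.m≤n+m _ _)))

        decision : DecidedBy Base (Related R) X N
        decision with em {P = R (proj₁ σ) (proj₁ τ)}
        ... | yes Rστ = inj₁ λ f f≡X _ → proj₁ σ , proj₁ τ , σ⊏ f f≡X , τ⊏ f f≡X , Rστ
        ... | no ¬Rστ = inj₂ λ f f≡X _ (s , t , s⊏ , t⊏ , Rst) →
          ¬Rστ (subst (λ u → R u (proj₁ τ)) (⊏-uniqueᵉ s⊏ (σ⊏ f f≡X))
            (subst (R s) (⊏-uniqueᵉ t⊏ (τ⊏ f f≡X)) Rst))

    abstract
      uniform : (R : Rel (Elements B) ℓ) → Base h →
                ∃[ g ] Base g × g ⊑ h × Uniform R g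
      uniform {h = h} R hB@(inc , _)
        with ramsey em (related R)
               (λ f≗g (inc , f∈) → (λ i → subst (_< _) (f≗g i) (subst (_ <_) (f≗g (suc i)) (inc i))) ,
                                   (λ i → subst (⋃ₗ B) (f≗g i) (f∈ i)))
               (λ f≗g (s , t , s⊏ , t⊏ , Rst) →
                 s , t , ⊏-cong s⊏ (λ i _ → f≗g (p i)) , ⊏-cong t⊏ (λ i _ → f≗g (q i)) , Rst)
               h inc
      ... | g , incg , g⊑h , homogeneous = g , gB , g⊑h , Sum.map pos neg homogeneous
        where
        gB : Base g
        gB = ⊑-base incg g⊑h hB
        -- `Related` provides one pair and `On` asks about every pair; they agree because a sequence
        -- begins with at most one barrier element.
        pos : OnSubsequences Base (Related R) g → On R g
        pos on X incX X⊑g s t s⊏ t⊏ =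
          let s′ , t′ , s′⊏ , t′⊏ , Rs′t′ = on X incX X⊑g (⊑-base incX X⊑g gB)
          in subst (λ u → R u t) (⊏-uniqueᵉ s′⊏ s⊏) (subst (R s′) (⊏-uniqueᵉ t′⊏ t⊏) Rs′t′)
        neg : OnSubsequences Base (∁ (Related R)) g → On (λ s t → ¬ R s t) g
        neg on X incX X⊑g s t s⊏ t⊏ Rst =
          on X incX X⊑g (⊑-base incX X⊑g gB) (s , t , s⊏ , t⊏ , Rst)

    uniform-all : (Rs : List (Rel (Elements B) ℓ)) → Base h →
                  ∃[ g ] Base g × g ⊑ h × All (λ R → Uniform R g) Rs
    uniform-all {h = h} []       hB = h , hB , ⊑-refl , []
    uniform-all         (R ∷ Rs) hB =
      let f , fB , f⊑h , Us = uniform-all Rs hB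
          g , gB , g⊑f , U  = uniform R fB
      in g , gB , ⊑-trans g⊑f f⊑h , U ∷ All.map (λ {R} → Uniform-⊑ {R = R} g⊑f) Us

-- Order types of restricted barriers

-- The Mostowski collapse of a subset S of a well-ordered set.
module Collapse (em : ∀ {ℓ} → ExcludedMiddle ℓ) (α : CountableOrdinal)
                (S : Pred (CountableOrdinal.Carrier α) 0ℓ) where
  open CountableOrdinal α
  private module ≺ = IsStrictTotalOrder isStrictTotalOrder

  Least : Pred Carrier 0ℓ → Pred Carrier 0ℓ
  Least A z = z ∈ A × (∀ w → w ≺ z → ¬ (w ∈ A))

  least : (A : Pred Carrier 0ℓ) → ∀ x → x ∈ A → ∃ (Least A)
  least A x x∈A = search x (wellFounded x) x∈A
    where
    search : ∀ x → Acc _≺_ x → x ∈ A → ∃ (Least A)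
    search x (acc rs) x∈A with em {P = ∃[ w ] w ≺ x × w ∈ A}
    ... | yes (w , w≺x , w∈A) = search w (rs w≺x) w∈A
    ... | no ¬∃ = x , x∈A , λ w w≺x w∈A → ¬∃ (w , w≺x , w∈A)

  least-unique : {A A′ : Pred Carrier 0ℓ} {z z′ : Carrier} → A ⊆ A′ → A′ ⊆ A →
                 Least A z → Least A′ z′ → z ≡ z′
  least-unique {z = z} {z′} A⊆A′ A′⊆A (z∈A , minz) (z′∈A′ , minz′) with ≺.compare z z′
  ... | tri< z≺z′ _ _ = ⊥-elim (minz′ z z≺z′ (A⊆A′ z∈A))
  ... | tri≈ _ z≡z′ _ = z≡z′
  ... | tri> _ _ z′≺z = ⊥-elim (minz z′ z′≺z (A′⊆A z′∈A′))

  mutual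
    collapse : ∀ x → Acc _≺_ x → Carrier
    collapse x ac = proj₁ (least (Free x ac) x (free-self x ac))

    Free : ∀ x → Acc _≺_ x → Pred Carrier 0ℓ
    Free x (acc rs) z = ∀ y (y≺x : y ≺ x) → y ∈ S → collapse y (rs y≺x) ≢ z

    -- If `collapse y` were `x` for some `y ≺ x`, then `y`, itself free for `y`, would lie below the
    -- least free value.
    free-self : ∀ x (ac : Acc _≺_ x) → x ∈ Free x ac
    free-self x (acc rs) y y≺x _ eq =
      proj₂ (proj₂ (least (Free y (rs y≺x)) y (free-self y (rs y≺x)))) y
        (subst (y ≺_) (sym eq) y≺x) (free-self y (rs y≺x))

  collapse-least : ∀ x (ac : Acc _≺_ x) → Least (Free x ac) (collapse x ac)
  collapse-least x ac = proj₂ (least (Free x ac) x (free-self x ac))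

  collapse-irrelevant : ∀ x (ac ac′ : Acc _≺_ x) → collapse x ac ≡ collapse x ac′
  collapse-irrelevant x ac@(acc rs) ac′@(acc rs′) = least-unique
    (λ free y y≺x y∈S eq → free y y≺x y∈S (trans (collapse-irrelevant y (rs y≺x) (rs′ y≺x)) eq))
    (λ free y y≺x y∈S eq → free y y≺x y∈S (trans (collapse-irrelevant y (rs′ y≺x) (rs y≺x)) eq))
    (collapse-least x ac) (collapse-least x ac′)

  π : Carrier → Carrier
  π x = collapse x (wellFounded x)

  π-distinct : ∀ {x y} → y ≺ x → y ∈ S → π y ≢ π x
  π-distinct {x} {y} y≺x y∈S = distinct (wellFounded x)
    where
    distinct : ∀ ac → π y ≢ collapse x ac
    distinct ac@(acc rs) eq =
      proj₁ (collapse-least x ac) y y≺x y∈S (trans (collapse-irrelevant y _ _) eq)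

  π-initial : ∀ x w → w ≺ π x → ∃[ y ] y ≺ x × y ∈ S × π y ≡ w
  π-initial x w = initial (wellFounded x)
    where
    initial : ∀ ac → w ≺ collapse x ac → ∃[ y ] y ≺ x × y ∈ S × π y ≡ w
    initial ac@(acc rs) w≺ = by-contradiction em λ ¬∃ →
      proj₂ (collapse-least x ac) w w≺ λ y y≺x y∈S eq →
        ¬∃ (y , y≺x , y∈S , trans (collapse-irrelevant y _ _) eq)

  π-mono : ∀ {x y} → y ≺ x → y ∈ S → π y ≺ π x
  π-mono {x} {y} y≺x y∈S with ≺.compare (π y) (π x)
  ... | tri< πy≺πx _ _ = πy≺πx
  ... | tri≈ _ πy≡πx _ = ⊥-elim (π-distinct y≺x y∈S πy≡πx)
  -- Initiality makes `π x` the value at some `y′` below `y`, hence below `x`, against distinctness.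
  ... | tri> _ _ πx≺πy =
    let y′ , y′≺y , y′∈S , πy′≡πx = π-initial y (π x) πx≺πy
    in ⊥-elim (π-distinct (≺.trans y′≺y y≺x) y′∈S πy′≡πx)

module _ (em : ∀ {ℓ} → ExcludedMiddle ℓ) where

  -- Restricting the embedding may leave gaps in its image; collapsing the image closes them.
  orderType-⊆ : {α : CountableOrdinal} {B B′ : Pred (List ℕ) 0ℓ} → B′ ⊆ B →
                OrderTypeAtMost α B → OrderTypeAtMost α B′
  orderType-⊆ {α} {B} {B′} B′⊆B type = record
    { embed    = π ∘ e
    ; monotone = λ s t s<t → π-mono (monotone (ι s) (ι t) s<t) (s , refl)
    ; initial  = λ s x x≺ →
        let y , _ , (t , et≡y) , πy≡x = π-initial (e s) x x≺
        in t , trans (cong π et≡y) πy≡x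
    }
    where
    open OrderTypeAtMost type
    ι : Elements B′ → Elements B
    ι = refine B′⊆B
    e : Elements B′ → CountableOrdinal.Carrier α
    e s = embed (ι s)
    open Collapse em α (λ y → ∃[ t ] e t ≡ y)

  -- The restriction `B ↾ h` is a barrier of type at most `α`, so it has a good pair, and `◁-shift`
  -- turns that pair into a subsequence of `h`.
  bqo-along : ∀ {c ℓ₁ ℓ₂} (Q : Preorder c ℓ₁ ℓ₂) {α : CountableOrdinal} {B : Pred (List ℕ) 0ℓ}
              (bar : IsBarrier B) → Bqo Q α → OrderTypeAtMost α B →
              (φ : Elements B → Preorder.Carrier Q) → Barrier.Base em bar h →
              ∃[ f ] Incr f × f ⊑ h ×
                ∃[ s ] ∃[ t ] value s ⊏ f × value t ⊏ f ∘ suc × Preorder._≲_ Q (φ s) (φ t)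
  bqo-along {h = h} Q {B = B} bar bqo type φ hB =
    let s , t , s◁t , φs≲φt = bqo (B ↾ h) (restrict-isBarrier hB) (orderType-⊆ proj₁ type)
                                  (φ ∘ refine proj₁)
        s∈B , s⊆h = element∈ em s
        t∈B , t⊆h = element∈ em t
        f , inc , f⊑h , s⊏f , t⊏f = ◁-shift s∈B t∈B s◁t (proj₁ hB) s⊆h t⊆h
    in f , inc , f⊑h , refine proj₁ s , refine proj₁ t , s⊏f , t⊏f , φs≲φt
    where open Barrier em bar

-- Interleaving sequences

double : ℕ → ℕ
double zero    = zero
double (suc n) = suc (suc (double n))

double-incr : Incr double
double-incr zero    = z<s
double-incr (suc i) = s<s (s<s (double-incr i))

interleave : (ℕ → ℕ) → (ℕ → ℕ) → ℕ → ℕ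
interleave f g zero    = f 0
interleave f g (suc n) = interleave g (f ∘ suc) n

interleave-double : ∀ f g i → interleave f g (double i) ≡ f i
interleave-double f g zero    = refl
interleave-double f g (suc i) = interleave-double (f ∘ suc) (g ∘ suc) i

interleave-incr : (∀ i → f i < g i) → (∀ i → g i < f (suc i)) → Incr (interleave f g)
interleave-incr f<g g<f zero    = f<g 0
interleave-incr f<g g<f (suc i) = interleave-incr g<f (f<g ∘ suc) i

interleave-⊑ : f ⊑ h → g ⊑ h → interleave f g ⊑ h
interleave-⊑ f⊑h g⊑h zero    = f⊑h 0
interleave-⊑ f⊑h g⊑h (suc i) = interleave-⊑ g⊑h (f⊑h ∘ suc) i

-- As `f` uses only even positions of `h`, the odd position right after each one used supplies a
-- point strictly between consecutive terms of `f`.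
weave : Incr h → Incr f → f ⊑ h ∘ double →
        ∃[ X ] Incr X × X ⊑ h × (∀ i → f i ≡ X (double i))
weave {h} {f} inch incf f⊑ =
  interleave f k , interleave-incr f<k k<f ,
  interleave-⊑ (⊑-trans f⊑ λ i → double i , refl) (λ i → suc (double (j i)) , refl) ,
  λ i → sym (interleave-double f k i)
  where
  j : ℕ → ℕ
  j i = proj₁ (f⊑ i)

  k : ℕ → ℕ
  k i = h (suc (double (j i)))

  j-incr : Incr j
  j-incr i = incr-cancel (incr-∘ inch double-incr)
    (subst (_< _) (proj₂ (f⊑ i)) (subst (f i <_) (proj₂ (f⊑ (suc i))) (incf i)))

  f<k : ∀ i → f i < k i
  f<k i = subst (_< k i) (sym (proj₂ (f⊑ i))) (inch _)

  double-gap : m < n → suc (double m) < double n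
  double-gap {zero}  {suc n} _   = s<s z<s
  double-gap {suc m} {suc n} m<n = s<s (s<s (double-gap (s<s⁻¹ m<n)))

  k<f : ∀ i → k i < f (suc i)
  k<f i = subst (k i <_) (sym (proj₂ (f⊑ (suc i)))) (incr-mono inch (double-gap (j-incr i)))

-- Two-element maximal antichains

module _ {c ℓ₁ ℓ₂} (P : Poset c ℓ₁ ℓ₂) where
  open Poset P renaming (_≤_ to _≤ᴾ_; refl to reflᴾ; trans to transᴾ)

  -- For an antichain formed by `x` and `y`, this is maximality.
  Comparable : Carrier → Carrier → Set (c ⊔ ℓ₂)
  Comparable x y = ∀ z → (z ≤ᴾ x ⊎ x ≤ᴾ z) ⊎ (z ≤ᴾ y ⊎ y ≤ᴾ z)

  -- The case where domination puts `xs` below `yt`. The last six hypotheses transfer relations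
  -- between the pairs (s, u) and (u, t), as homogeneity permits. Comparing `xs`, and then `xt`,
  -- with the antichain of u gives `xs ≤ᴾ xt` or one of the impossible relations `xt ≤ᴾ xs` and
  -- `xt ≤ᴾ yt`.
  between : ∀ {xs ys xu yu xt yt} → Comparable xs ys → Comparable xu yu → ¬ xt ≤ᴾ yt →
            xs ≤ᴾ yt → ys ≤ᴾ xt ⊎ ys ≤ᴾ yt →
            (xs ≤ᴾ xu → xu ≤ᴾ xt) → (xu ≤ᴾ xt → xs ≤ᴾ xu) →
            (xu ≤ᴾ xs → xt ≤ᴾ xu) → (xt ≤ᴾ xu → xu ≤ᴾ xs) →
            (yu ≤ᴾ xs → yt ≤ᴾ xu) → (ys ≤ᴾ yu → yu ≤ᴾ yt) → xs ≤ᴾ xt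
  between {xs} {ys} {xu} {yu} {xt} {yt} cmps cmpu xt≰yt xs≤yt ys≤ xx xx⁻¹ xx′ xx′⁻¹ yx yy
    with cmps xt
  ... | inj₁ (inj₁ xt≤xs) = ⊥-elim (xt≰yt (transᴾ xt≤xs xs≤yt))
  ... | inj₁ (inj₂ xs≤xt) = xs≤xt
  ... | inj₂ xt~ys = conclude
    where
    ys≤xt : ys ≤ᴾ xt
    ys≤xt = Sum.[ id , (λ ys≤yt →
      Sum.[ (λ xt≤ys → ⊥-elim (xt≰yt (transᴾ xt≤ys ys≤yt))) , id ] xt~ys) ] ys≤

    xt≰xs : ¬ xt ≤ᴾ xs
    xt≰xs xt≤xs = xt≰yt (transᴾ xt≤xs xs≤yt)

    via-xu : xs ≤ᴾ xu → xs ≤ᴾ xt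
    via-xu p = transᴾ p (xx p)

    conclude : xs ≤ᴾ xt
    conclude with cmpu xs
    ... | inj₁ (inj₁ xs≤xu) = via-xu xs≤xu
    ... | inj₁ (inj₂ xu≤xs) = ⊥-elim (xt≰xs (transᴾ (xx′ xu≤xs) xu≤xs))
    -- Transfer gives `yt ≤ᴾ xu`, hence `xs ≤ᴾ yt ≤ᴾ xu`.
    ... | inj₂ (inj₂ yu≤xs) = via-xu (transᴾ xs≤yt (yx yu≤xs))
    ... | inj₂ (inj₁ xs≤yu) with cmpu xt
    ...   | inj₁ (inj₁ xt≤xu) = ⊥-elim (xt≰xs (transᴾ xt≤xu (xx′⁻¹ xt≤xu)))
    ...   | inj₁ (inj₂ xu≤xt) = via-xu (xx⁻¹ xu≤xt)
    ...   | inj₂ (inj₂ yu≤xt) = transᴾ xs≤yu yu≤xt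
    -- Here `ys ≤ᴾ xt ≤ᴾ yu`, so transfer gives `yu ≤ᴾ yt` and then `xt ≤ᴾ yt`.
    ...   | inj₂ (inj₁ xt≤yu) =
      ⊥-elim (xt≰yt (transᴾ xt≤yu (yy (transᴾ ys≤xt xt≤yu))))

  module _ (A : TwoMaximalAntichain P) where
    open TwoMaximalAntichain A
    open IsMaximalAntichain isMaximalAntichain
    open IsAntichain isAntichain

    record Partner (x : Carrier) : Set (c ⊔ ℓ₁ ⊔ ℓ₂) where
      field
        y      : Carrier
        y∈     : y ∈ set
        x≉y    : ¬ x ≈ y
        only   : ∀ z → z ∈ set → z ≈ x ⊎ z ≈ y

    partner : ∀ {x} → x ∈ set → Partner x
    partner {x} x∈ with twoElements
    ... | a , b , a∈ , b∈ , a≉b , only with only x x∈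
    ...   | inj₁ x≈a = record
      { y = b ; y∈ = b∈ ; x≉y = λ x≈b → a≉b (Eq.trans (Eq.sym x≈a) x≈b)
      ; only = λ z z∈ → Sum.map₁ (λ z≈a → Eq.trans z≈a (Eq.sym x≈a)) (only z z∈) }
    ...   | inj₂ x≈b = record
      { y = a ; y∈ = a∈ ; x≉y = λ x≈a → a≉b (Eq.trans (Eq.sym x≈a) x≈b)
      ; only = λ z z∈ → Sum.swap (Sum.map₂ (λ z≈b → Eq.trans z≈b (Eq.sym x≈b)) (only z z∈)) }

    module _ (em : ∀ {ℓ} → ExcludedMiddle ℓ) {x : Carrier} (x∈ : x ∈ set) (p : Partner x) where
      open Partner p

      -- Adding a `z` incomparable to both elements leaves an antichain. Maximality then puts `z` in
      -- the set, no member of which is above `z`, against reflexivity.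
      partner-comparable : Comparable x y
      partner-comparable z = by-contradiction em λ z∥ →
        let z≰x = z∥ ∘ inj₁ ∘ inj₁
            x≰z = z∥ ∘ inj₁ ∘ inj₂
            z≰y = z∥ ∘ inj₂ ∘ inj₁
            y≰z = z∥ ∘ inj₂ ∘ inj₂
            z≰ : ∀ w → w ∈ set → ¬ z ≤ᴾ w
            z≰ w w∈ z≤w = Sum.[ (λ w≈x → z≰x (≤-respʳ-≈ w≈x z≤w))
                              , (λ w≈y → z≰y (≤-respʳ-≈ w≈y z≤w)) ] (only w w∈)
            ≰z : ∀ w → w ∈ set → ¬ w ≤ᴾ z
            ≰z w w∈ w≤z = Sum.[ (λ w≈x → x≰z (≤-respˡ-≈ w≈x w≤z))
                              , (λ w≈y → y≰z (≤-respˡ-≈ w≈y w≤z)) ] (only w w∈)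
            antichain : IsAntichain P (λ w → w ∈ set ⊎ Lift (c ⊔ ℓ₁ ⊔ ℓ₂) (w ≈ z))
            antichain = record
              { respects = λ { u≈v (inj₁ u∈) → inj₁ (respects u≈v u∈)
                             ; u≈v (inj₂ (lift u≈z)) → inj₂ (lift (Eq.trans (Eq.sym u≈v) u≈z)) }
              ; incomparable = λ
                  { u v (inj₁ u∈) (inj₁ v∈) → incomparable u v u∈ v∈
                  ; u v (inj₁ u∈) (inj₂ (lift v≈z)) _ u≤v → ≰z u u∈ (≤-respʳ-≈ v≈z u≤v)
                  ; u v (inj₂ (lift u≈z)) (inj₁ v∈) _ u≤v → z≰ v v∈ (≤-respˡ-≈ u≈z u≤v)
                  ; u v (inj₂ (lift u≈z)) (inj₂ (lift v≈z)) u≉v _ →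
                      u≉v (Eq.trans u≈z (Eq.sym v≈z)) }
              }
        in z≰ z (maximal _ antichain inj₁ (inj₂ (lift Eq.refl))) reflᴾ

      x≰y : ¬ x ≤ᴾ y
      x≰y = incomparable x y x∈ y∈ x≉y

      dominated-by : ∀ {w} → ∃[ z ] z ∈ set × w ≤ᴾ z → w ≤ᴾ x ⊎ w ≤ᴾ y
      dominated-by (z , z∈ , w≤z) =
        Sum.map (λ z≈x → ≤-respʳ-≈ z≈x w≤z) (λ z≈y → ≤-respʳ-≈ z≈y w≤z) (only z z∈)

  -- Transfer of goodness between antichains and their union

  module _ (em : ∀ {ℓ} → ExcludedMiddle ℓ) (α : CountableOrdinal) where

    module _ (⋃-bqo : Bqo (Poset.preorder (⋃AM₂ P)) α) {B : Pred (List ℕ) 0ℓ} (bar : IsBarrier B)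
             (type : OrderTypeAtMost α B) (A : Elements B → TwoMaximalAntichain P) where
      open Barrier em bar
      open Colouring id suc (λ i → ℕ.n<1+n i) (λ i → ℕ.n<1+n (suc i))

      -- The negative colour is impossible: the bqo hypothesis yields a good pair inside `g`.
      monotone-along : (φ : Elements B → Σ Carrier (InUnion P)) → Base h →
                       ∃[ g ] Base g × g ⊑ h × On (λ s t → proj₁ (φ s) ≤ᴾ proj₁ (φ t)) g
      monotone-along φ hB with uniform (λ s t → proj₁ (φ s) ≤ᴾ proj₁ (φ t)) hB
      ... | g , gB , g⊑h , inj₁ on  = g , gB , g⊑h , on
      ... | g , gB , g⊑h , inj₂ off
        with bqo-along em (Poset.preorder (⋃AM₂ P)) bar ⋃-bqo type φ gB
      ...   | f , inc , f⊑g , s , t , s⊏ , t⊏ , φs≤φt = ⊥-elim (off f inc f⊑g s t s⊏ t⊏ φs≤φt)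

      left right : Elements B → Σ Carrier (InUnion P)
      left  s = let x , _ , x∈ , _ = TwoMaximalAntichain.twoElements (A s) in x , A s , x∈
      right s = let _ , y , _ , y∈ , _ = TwoMaximalAntichain.twoElements (A s) in y , A s , y∈

      dominates : ∀ s t → proj₁ (left s) ≤ᴾ proj₁ (left t) → proj₁ (right s) ≤ᴾ proj₁ (right t) →
                  Dominated P (TwoMaximalAntichain.set (A s)) (TwoMaximalAntichain.set (A t))
      dominates s t left≤ right≤ z z∈
        with TwoMaximalAntichain.twoElements (A s) | TwoMaximalAntichain.twoElements (A t)
      ... | _ , _ , _ , _ , _ , only | x , y , x∈ , y∈ , _ with only z z∈
      ...   | inj₁ z≈x = x , x∈ , ≤-respˡ-≈ (Eq.sym z≈x) left≤
      ...   | inj₂ z≈y = y , y∈ , ≤-respˡ-≈ (Eq.sym z≈y) right≤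

      AM₂-good : Good (AM₂ P) B A
      AM₂-good with monotone-along left (proj₂ base)
      -- The second thinning happens inside `h`, so monotonicity of the left coordinate survives.
      ... | h , hB , _ , left≤ with monotone-along right hB
      ... | g , gB@(inc , _) , g⊑h , right≤
        with segmentᵉ gB | segmentᵉ (⊑-base (inc ∘ suc) (λ i → suc i , refl) gB)
      ... | s , s⊏ | t , t⊏ =
        s , t , shift-◁ (element∈ em s) (element∈ em t) inc s⊏ t⊏ ,
        dominates s t (left≤ g inc g⊑h s t s⊏ t⊏) (right≤ g inc ⊑-refl s t s⊏ t⊏)

    module _ (AM₂-bqo : Bqo (AM₂ P) α) {B : Pred (List ℕ) 0ℓ} (bar : IsBarrier B)
             (type : OrderTypeAtMost α B) (φ : Elements B → Σ Carrier (InUnion P)) where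
      open Barrier em bar
      open Colouring double (suc ∘ double) double-incr (λ i → s<s (double-incr i))

      x : Elements B → Carrier
      x s = proj₁ (φ s)

      A : Elements B → TwoMaximalAntichain P
      A s = proj₁ (proj₂ (φ s))

      x∈ : ∀ s → x s ∈ TwoMaximalAntichain.set (A s)
      x∈ s = proj₂ (proj₂ (φ s))

      pair : ∀ s → Partner (A s) (x s)
      pair s = partner (A s) (x∈ s)

      y : Elements B → Carrier
      y s = Partner.y (pair s)

      -- Exactly the relations whose transfer `between` uses, the first two in both directions.
      relations : List (Rel (Elements B) ℓ₂)
      relations = (λ s t → x s ≤ᴾ x t) ∷ (λ s t → x t ≤ᴾ x s) ∷
                  (λ s t → y t ≤ᴾ x s) ∷ (λ s t → y s ≤ᴾ y t) ∷ []

      -- The element u along the odd terms of X interleaves both with s and with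
      -- t, so the uniform relations hold for (s , u) iff they hold for (u , t).
      x-monotone : Base h → All (λ R → Uniform R h) relations → ∀ X → Incr X → X ⊑ h →
                   ∀ s t → value s ⊏ X ∘ double → value t ⊏ X ∘ double ∘ suc →
                   Dominated P (TwoMaximalAntichain.set (A s)) (TwoMaximalAntichain.set (A t)) →
                   x s ≤ᴾ x t
      x-monotone {h} hB (U₁ ∷ U₂ ∷ U₃ ∷ U₄ ∷ []) X inc X⊑h s t s⊏ t⊏ dom
        with segmentᵉ (⊑-base (incr-∘ (inc ∘ suc) double-incr)
                              (⊑-trans (λ i → suc (double i) , refl) X⊑h) hB)
      ... | u , u⊏ with dominated-by (A t) em (x∈ t) (pair t) (dom (x s) (x∈ s))
      ...   | inj₁ xs≤xt = xs≤xt
      ...   | inj₂ xs≤yt = between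
        (partner-comparable (A s) em (x∈ s) (pair s))
        (partner-comparable (A u) em (x∈ u) (pair u))
        (x≰y (A t) em (x∈ t) (pair t)) xs≤yt
        (dominated-by (A t) em (x∈ t) (pair t) (dom (y s) (Partner.y∈ (pair s))))
        (su⇒ut _ U₁) (ut⇒su _ U₁) (su⇒ut _ U₂) (ut⇒su _ U₂) (su⇒ut _ U₃) (su⇒ut _ U₄)
        where
        su⇒ut : (R : Rel (Elements B) ℓ₂) → Uniform R h → R s u → R u t
        -- Dropping the first term of `X` moves `u` to the even positions and `t` to the odd ones.
        su⇒ut _ (inj₁ on)  _   = on (X ∘ suc) (inc ∘ suc) (X⊑h ∘ suc) u t u⊏ t⊏
        su⇒ut _ (inj₂ off) Rsu = ⊥-elim (off X inc X⊑h s u s⊏ u⊏ Rsu)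

        ut⇒su : (R : Rel (Elements B) ℓ₂) → Uniform R h → R u t → R s u
        ut⇒su _ (inj₁ on)  _   = on X inc X⊑h s u s⊏ u⊏
        ut⇒su _ (inj₂ off) Rut = ⊥-elim (off (X ∘ suc) (inc ∘ suc) (X⊑h ∘ suc) u t u⊏ t⊏ Rut)

      ⋃AM₂-good : Good (Poset.preorder (⋃AM₂ P)) B φ
      ⋃AM₂-good with uniform-all relations (proj₂ base)
      ... | h , hB , _ , uniforms
        -- Only the even terms of `h` are used here, which reserves the odd ones for `weave`.
        with bqo-along em (AM₂ P) bar AM₂-bqo type A
               (⊑-base (incr-∘ (proj₁ hB) double-incr) (λ i → double i , refl) hB)
      ... | f , inc , f⊑ , s , t , s⊏ , t⊏ , dom with weave (proj₁ hB) inc f⊑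
      ... | X , incX , X⊑h , f≡X =
        s , t , shift-◁ (element∈ em s) (element∈ em t) inc s⊏ t⊏ ,
        x-monotone hB uniforms X incX X⊑h s t
          (⊏-cong s⊏ λ i _ → f≡X i) (⊏-cong t⊏ λ i _ → f≡X (suc i)) dom

theorem6p3 : (∀ {ℓ} → ExcludedMiddle ℓ) →
    ∀ {c ℓ₁ ℓ₂} (P : Poset c ℓ₁ ℓ₂) → NoInfiniteAntichain P →
    (α : CountableOrdinal) →
    Bqo (AM₂ P) α ⇔ Bqo (Poset.preorder (⋃AM₂ P)) α
theorem6p3 em P _ α = mk⇔
  (λ AM₂-bqo B bar type φ → ⋃AM₂-good P em α AM₂-bqo bar type φ)
  (λ ⋃-bqo B bar type A → AM₂-good P em α ⋃-bqo bar type A)
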